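{- Let $P$ be a linear lasso program over $K^n$ in the normal form below, let $T$ be a linear ranking function template written in conjunctive normal form as below, and let $L$ be a finite index set with strictness symbols $\rhd_\ell\in\{\ge,>\}$ for $\ell\in L$. If the constraint $(\mathrm{II0})\wedge(\mathrm{IC0})\wedge(\mathrm{TI0})$ is satisfiable, then so is the constraint $(\mathrm{II5})\wedge(\mathrm{IC5})\wedge(\mathrm{TI5})$ (both defined below).
   Context: $K$ is $\mathbb{Q}$ or a real closed field; vectors are column vectors, $v^T$ is the transpose, $(x;x')\in K^{2n}$ is the stacked vector, vector inequalities are componentwise. A lasso program over $K^n$ is a pair $P=(\mathrm{stem},\mathrm{loop})$, $\mathrm{stem}\subseteq K^n$, $\mathrm{loop}\subseteq K^n\times K^n$; an execution is a finite or infinite sequence $\sigma_0\sigma_1\ldots$ with $\sigma_0\in\mathrm{stem}$ and $(\sigma_i,\sigma_{i+1})\in\mathrm{loop}$; $P$ terminates iff it has no infinite execution. $P$ is given in normal form: $\mathrm{stem}(x)\equiv\bigvee_{\nu\in N}(B_\nu x\le b_\nu\wedge B'_\nu x<b'_\nu)$, $\mathrm{loop}(x,x')\equiv\bigvee_{m\in M}(A_m(x;x')\le c_m\wedge A'_m(x;x')<c'_m)$, finite $N,M$, constant matrices/vectors over $K$. Templates: a template is a quantifier-free formula $T(x,x')$ that additionally contains a finite set $D$ of unknown scalars and a finite set $F$ of affine-linear function symbols, each $f\in F$ standing for $x\mapsto s_f^Tx+t_f$ with unknowns $s_f\in K^n,t_f\in K$. $T$ is a ranking function template iff for every lasso program $Q$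 over $K^n$, if some assignment to the unknowns makes $\forall\sigma,\sigma'.\ (\sigma,\sigma')\in\mathrm{loop}_Q\to T(\sigma,\sigma')$ true, then $Q$ terminates; it is linear if moreover it is a boolean combination of atoms $\sum_{f\in F}(\alpha_f f(x)+\beta_f f(x'))+\sum_{d\in D}\gamma_d d\rhd 0$ with constants $\alpha_f,\beta_f,\gamma_d\in K$, $\rhd\in\{\ge,>\}$. Here $T\equiv\bigwedge_{i\in I}\bigvee_{j\in J_i}T_{i,j}(x,x')$ (CNF), each atom occurrence written as $d_{i,j}^T(x;x')\rhd_{i,j}e_{i,j}$ with $d_{i,j}=(\sum_f\alpha_f s_f;\sum_f\beta_f s_f)$, $e_{i,j}=-(\sum_f(\alpha_f+\beta_f)t_f+\sum_d\gamma_d d)$. Original constraint: for $\ell\in L$ let $\psi_\ell(x)\equiv s_\ell^Tx+t_\ell\rhd_\ell0$ with unknowns $s_\ell\in K^n,t_\ell\in K$. (II0) is $\bigwedge_{\ell\in L}\forall x.\ \mathrm{stem}(x)\to\psi_\ell(x)$; (IC0) is $\bigwedge_{\ell\in L}\forall x,x'.\ \psi_\ell(x)\wedge\mathrm{loop}(x,x')\to\psi_\ell(x')$; (TI0) is $\forall x,x'.\ \mathrm{loop}(x,x')\wedge\bigwedge_{\ell\in L}\psi_\ell(x)\to T(x,x')$. Transformed constraint: let $L'=L\times I\times M$; for $\ell'=(\ell,i,m)\in L'$ introduce fresh unknowns $s_{\ell'}\in K^n,t_{\ell'}\in K$ and $\psi_{\ell'}(x)\equiv s_{\ell'}^Tx+t_{\ell'}\rhd_\ell0$.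 Read $\neg(a\ge b)$ as $a<b$ and $\neg(a>b)$ as $a\le b$. Consider (II4) for $\ell'\in L'$, $\nu\in N$: $\forall x.\ \neg(B_\nu x\le b_\nu\wedge B'_\nu x<b'_\nu\wedge\neg\psi_{\ell'}(x))$; (IC4) for $\ell'\in L'$, $m\in M$: $\forall x,x'.\ \neg(\psi_{\ell'}(x)\wedge A_m(x;x')\le c_m\wedge A'_m(x;x')<c'_m\wedge\neg\psi_{\ell'}(x'))$; (TI4) for $i\in I$, $m\in M$: $\forall x,x'.\ \neg\big(A_m(x;x')\le c_m\wedge A'_m(x;x')<c'_m\wedge\bigwedge_{\ell\in L}\psi_{(\ell,i,m)}(x)\wedge\bigwedge_{j\in J_i}\neg T_{i,j}(x,x')\big)$. In each, with $z$ the quantified vector, write every conjunct inside $\neg(\ldots)$ (matrix rows separately) as $p_k^Tz\le q_k$ ($k\in R_\le$) or $p_k^Tz<q_k$ ($k\in R_<$) by collecting $z$-terms on the left, without rescaling. Its Motzkin transform is $\exists(\kappa_k)_k\ge0.\ \sum_k\kappa_kp_k=0\wedge\sum_k\kappa_kq_k\le0\wedge(\sum_{k\in R_\le}\kappa_kq_k<0\vee\sum_{k\in R_<}\kappa_k>0)$. (II5), (IC5), (TI5) are the conjunctions of the Motzkin transforms (fresh coefficients each) of all formulas in (II4), (IC4), (TI4). A constraint is satisfiable iff some values in $K$ for all its unknowns (invariant coefficients, template coefficients $s_f,t_f$, and $d\in D$) make it true in $K$. -}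

module Defs where

open import Data.Nat as ℕ using (ℕ; zero; suc)
open import Data.Fin using (Fin; zero; suc; toℕ; splitAt)
open import Data.Bool using (Bool; true; false; not; if_then_else_)
open import Data.Product using (Σ; _×_; _,_)
open import Data.Sum using (_⊎_; [_,_])
open import Data.List using (List; []; _∷_; _++_; length; lookup; tabulate)
open import Relation.Nullary using (¬_)
open import Relation.Binary.PropositionalEquality using (_≡_; _≢_)
open import Relation.Binary.Structures using (IsTotalOrder)
open import Algebra.Structures using (IsCommutativeRing)
open import Data.Rational as Q using (ℚ; 0ℚ; 1ℚ)

record FieldOps : Set₁ where
  infixl 6 _+_
  infixl 7 _*_
  infix 4 _≤_ _<_
  field
    Carrier : Set
    0# 1#   : Carrier
    _+_ _*_ : Carrier → Carrier → Carrier
    -_      : Carrier → Carrier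
    _≤_ _<_ : Carrier → Carrier → Set

-- K = ℚ (stdlib rationals, normalised, so _≡_ is the field equality)
ℚOps : FieldOps
ℚOps = record
  { Carrier = ℚ ; 0# = 0ℚ ; 1# = 1ℚ
  ; _+_ = Q._+_ ; _*_ = Q._*_ ; -_ = Q.-_
  ; _≤_ = Q._≤_ ; _<_ = Q._<_ }

module _ (K : FieldOps) where
  open FieldOps K

  pow : Carrier → ℕ → Carrier
  pow x zero    = 1#
  pow x (suc k) = x * pow x k

  ∑ : ∀ {n} → (Fin n → Carrier) → Carrier
  ∑ {zero}  f = 0#
  ∑ {suc n} f = f zero + ∑ (λ i → f (suc i))

  evalMonic : (d : ℕ) → (Fin d → Carrier) → Carrier → Carrier
  evalMonic d a x = pow x d + ∑ (λ i → a i * pow x (toℕ i))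

  record IsRealClosedField : Set where
    field
      isCommutativeRing : IsCommutativeRing _≡_ _+_ _*_ -_ 0# 1#
      0≢1          : 0# ≢ 1#
      inverse      : ∀ x → x ≢ 0# → Σ Carrier (λ y → x * y ≡ 1#)
      isTotalOrder : IsTotalOrder _≡_ _≤_
      <⇒≤×≢        : ∀ x y → x < y → (x ≤ y) × (x ≢ y)
      ≤×≢⇒<        : ∀ x y → x ≤ y → x ≢ y → x < y
      +-mono-≤     : ∀ x y z → x ≤ y → x + z ≤ y + z
      *-nonneg     : ∀ x y → 0# ≤ x → 0# ≤ y → 0# ≤ x * y
      sqrt         : ∀ x → 0# ≤ x → Σ Carrier (λ y → y * y ≡ x)
      oddRoot      : ∀ k (a : Fin (suc (2 ℕ.* k)) → Carrier) →
                     Σ Carrier (λ x → evalMonic (suc (2 ℕ.* k)) a x ≡ 0#)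

QorRCF : FieldOps → Set₁
QorRCF K = (K ≡ ℚOps) ⊎ IsRealClosedField K

data Strictness : Set where
  geq gt : Strictness

isStrict : Strictness → Bool
isStrict geq = false
isStrict gt  = true

module _ (K : FieldOps) where
  open FieldOps K

  Vect : ℕ → Set
  Vect n = Fin n → Carrier

  holds : Strictness → Carrier → Set
  holds geq a = 0# ≤ a
  holds gt  a = 0# < a

  dot : ∀ {n} → Vect n → Vect n → Carrier
  dot u v = ∑ K (λ i → u i * v i)

  negV : ∀ {n} → Vect n → Vect n
  negV v i = - v i

  zeroV : ∀ {n} → Vect n
  zeroV _ = 0#

  stack : ∀ {n} → Vect n → Vect n → Vect (n ℕ.+ n)
  stack {n} x x' i = [ x , x' ] (splitAt n i)

  Terminates : ∀ {n} → (Vect n → Set) → (Vect n → Vect n → Set) → Set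
  Terminates {n} stem loop =
    ¬ Σ (ℕ → Vect n) (λ σ → stem (σ 0) × (∀ i → loop (σ i) (σ (suc i))))

  record Conj (d : ℕ) : Set where
    field
      r r' : ℕ
      B    : Fin r → Vect d
      b    : Fin r → Carrier
      B'   : Fin r' → Vect d
      b'   : Fin r' → Carrier

  ⟦_⟧C : ∀ {d} → Conj d → Vect d → Set
  ⟦ C ⟧C z = (∀ k → dot (B k) z ≤ b k) × (∀ k → dot (B' k) z < b' k)
    where open Conj C

  record LassoNF (n : ℕ) : Set where
    field
      nN    : ℕ
      stemC : Fin nN → Conj n
      nM    : ℕ
      loopC : Fin nM → Conj (n ℕ.+ n)

  module _ {n : ℕ} (P : LassoNF n) where
    open LassoNF P
    stemP : Vect n → Set
    stemP x = Σ (Fin nN) (λ ν → ⟦ stemC ν ⟧C x)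
    loopP : Vect n → Vect n → Set
    loopP x x' = Σ (Fin nM) (λ m → ⟦ loopC m ⟧C (stack x x'))

  -- atom  Σ_f (α_f f(x) + β_f f(x')) + Σ_d γ_d d ▷ 0
  record Atom (nF nD : ℕ) : Set where
    field
      α β : Fin nF → Carrier
      γ   : Fin nD → Carrier
      rel : Strictness

  record TemplateCNF : Set where
    field
      nF nD : ℕ
      nI    : ℕ
      nJ    : Fin nI → ℕ
      atom  : (i : Fin nI) → Fin (nJ i) → Atom nF nD

  record TAssign (n : ℕ) (T : TemplateCNF) : Set where
    open TemplateCNF T
    field
      s    : Fin nF → Vect n
      t    : Fin nF → Carrier
      dval : Fin nD → Carrier

  module _ {n : ℕ} {T : TemplateCNF} (a : TAssign n T) where
    open TemplateCNF T
    open TAssign a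

    atomVal : Atom nF nD → Vect n → Vect n → Carrier
    atomVal A x x' =
      ∑ K (λ f → α f * (dot (s f) x + t f) + β f * (dot (s f) x' + t f))
        + ∑ K (λ d → γ d * dval d)
      where open Atom A

    ⟦T⟧ : Vect n → Vect n → Set
    ⟦T⟧ x x' = ∀ i → Σ (Fin (nJ i)) (λ j → holds (Atom.rel (atom i j)) (atomVal (atom i j) x x'))

    atomD : Atom nF nD → Vect (n ℕ.+ n)
    atomD A = stack (λ k → ∑ K (λ f → α f * s f k)) (λ k → ∑ K (λ f → β f * s f k))
      where open Atom A
    atomE : Atom nF nD → Carrier
    atomE A = - (∑ K (λ f → (α f + β f) * t f) + ∑ K (λ d → γ d * dval d))
      where open Atom A

  IsRankingTemplate : (n : ℕ) → TemplateCNF → Set₁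
  IsRankingTemplate n T =
    ∀ (stemQ : Vect n → Set) (loopQ : Vect n → Vect n → Set) →
      Σ (TAssign n T) (λ a → ∀ σ σ' → loopQ σ σ' → ⟦T⟧ a σ σ') →
      Terminates stemQ loopQ

  module _ {n : ℕ} (P : LassoNF n) (T : TemplateCNF) (nL : ℕ) (▷ : Fin nL → Strictness) where

    ψ : Vect n → Carrier → Strictness → Vect n → Set
    ψ s t r x = holds r (dot s x + t)

    Sat0 : Set
    Sat0 =
      Σ (Fin nL → Vect n) λ sL → Σ (Fin nL → Carrier) λ tL → Σ (TAssign n T) λ a →
        (∀ ℓ x → stemP P x → ψ (sL ℓ) (tL ℓ) (▷ ℓ) x)
      × (∀ ℓ x x' → ψ (sL ℓ) (tL ℓ) (▷ ℓ) x → loopP P x x' → ψ (sL ℓ) (tL ℓ) (▷ ℓ) x')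
      × (∀ x x' → loopP P x x' → (∀ ℓ → ψ (sL ℓ) (tL ℓ) (▷ ℓ) x) → ⟦T⟧ a x x')

  -- Motzkin transform of  ¬(⋀_k p_k^T z (≤ or <) q_k)

  record Row (d : ℕ) : Set where
    constructor row
    field
      p      : Vect d
      q      : Carrier
      strict : Bool      -- true: p^T z < q ;  false: p^T z ≤ q

  Motzkin : ∀ {d} → List (Row d) → Set
  Motzkin {d} rs =
    Σ (Fin (length rs) → Carrier) λ κ →
        (∀ k → 0# ≤ κ k)
      × (∀ i → ∑ K (λ k → κ k * Row.p (lookup rs k) i) ≡ 0#)
      × (∑ K (λ k → κ k * Row.q (lookup rs k)) ≤ 0#)
      × ( (∑ K (λ k → if Row.strict (lookup rs k) then 0# else κ k * Row.q (lookup rs k)) < 0#)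
        ⊎ (0# < ∑ K (λ k → if Row.strict (lookup rs k) then κ k else 0#)))

  conjRows : ∀ {d} → Conj d → List (Row d)
  conjRows C = tabulate (λ k → row (B k) (b k) false) ++ tabulate (λ k → row (B' k) (b' k) true)
    where open Conj C

  -- ψ(z)  ≡  s^T z + t ▷ 0,  written as  (-s)^T z ≤/< t
  posRow : ∀ {d} → Vect d → Carrier → Strictness → Row d
  posRow s t r = row (negV s) t (isStrict r)

  -- ¬ψ(z) ≡  s^T z + t </≤ 0, written as  s^T z </≤ -t
  negRow : ∀ {d} → Vect d → Carrier → Strictness → Row d
  negRow s t r = row s (- t) (not (isStrict r))

  -- ¬(d^T z ▷ e)  written as  d^T z </≤ e
  negAtomRow : ∀ {d} → Vect d → Carrier → Strictness → Row d
  negAtomRow dd e r = row dd e (not (isStrict r))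

  module _ {n : ℕ} (P : LassoNF n) (T : TemplateCNF) (nL : ℕ) (▷ : Fin nL → Strictness) where
    open LassoNF P
    open TemplateCNF T

    Sat5 : Set
    Sat5 =
      Σ (Fin nL → Fin nI → Fin nM → Vect n) λ sL → Σ (Fin nL → Fin nI → Fin nM → Carrier) λ tL →
      Σ (TAssign n T) λ a →
        (∀ ℓ i m ν → Motzkin
           (conjRows (stemC ν) ++ (negRow (sL ℓ i m) (tL ℓ i m) (▷ ℓ) ∷ [])))
      × (∀ ℓ i m m₁ → Motzkin
           (posRow (stack (sL ℓ i m) zeroV) (tL ℓ i m) (▷ ℓ)
             ∷ (conjRows (loopC m₁)
             ++ (negRow (stack zeroV (sL ℓ i m)) (tL ℓ i m) (▷ ℓ) ∷ []))))
      × (∀ i m → Motzkin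
           (conjRows (loopC m)
             ++ tabulate (λ ℓ → posRow (stack (sL ℓ i m) zeroV) (tL ℓ i m) (▷ ℓ))
             ++ tabulate (λ j → negAtomRow (atomD a (atom i j)) (atomE a (atom i j))
                                             (Atom.rel (atom i j)))))

{-# OPTIONS --safe #-}

-- Giving ψ_(ℓ,i,m) the coefficients of ψ_ℓ for all i and m turns a solution of the original
-- constraint into one in which the systems inside ¬(…) of (II4), (IC4), (TI4) have no solution.
-- What remains is the completeness of Motzkin's transform over a discrete ordered field, proved
-- by Fourier–Motzkin elimination: a system is either solvable, or the cone generated by its rows
-- contains a false row 0 ≤ q or 0 < q.

module Submission where

open import Defs
open import Algebra.Bundles using (CommutativeRing)
open import Algebra.Structures using (IsCommutativeRing)
import Algebra.Properties.Ring
import Algebra.Solver.Ring.NaturalCoefficients.Default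
open import Data.Bool using (Bool; true; false; not; if_then_else_; _∨_)
open import Data.Empty using (⊥)
open import Data.Fin using (Fin; zero; suc; splitAt; _↑ˡ_; _↑ʳ_)
open import Data.Fin.Properties using (splitAt-↑ˡ; splitAt-↑ʳ; join-splitAt)
open import Data.List using (List; []; _∷_; _++_; length; lookup; tabulate; cartesianProductWith)
open import Data.List.Membership.Propositional using (_∈_)
open import Data.List.Membership.Propositional.Properties using (∈-cartesianProductWith⁺; ∈-cartesianProductWith⁻)
open import Data.List.Relation.Unary.All as All using (All; []; _∷_)
open import Data.List.Relation.Unary.All.Properties using (++⁺; ++⁻; tabulate⁻)
open import Data.List.Relation.Unary.Any using (here; there; index)
open import Data.List.Relation.Unary.Any.Properties using (lookup-index)
open import Data.Nat as ℕ using (ℕ; zero; suc)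
open import Data.Product using (Σ; Σ-syntax; _×_; _,_; proj₁; proj₂)
import Data.Rational as ℚ
import Data.Rational.Properties as ℚ
open import Data.Sum using (_⊎_; inj₁; inj₂; [_,_]; swap)
open import Data.Vec.Functional using () renaming (_∷_ to _∷ᵥ_)
open import Function using (_∘_)
open import Relation.Binary.PropositionalEquality using (_≡_; _≢_; refl; sym; trans; cong; cong₂; subst; subst₂; module ≡-Reasoning)
open import Relation.Binary.Structures using (IsTotalOrder)
open import Relation.Nullary using (¬_; Dec; yes; no; contradiction)

inj₁≢inj₂ : ∀ {A B : Set} {a : A} {b : B} → inj₁ a ≡ inj₂ b → ⊥
inj₁≢inj₂ ()

-- Ordered fields, the common ground of both cases of `QorRCF`

record IsOrderedField (K : FieldOps) : Set where
  open FieldOps K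
  field
    isCommutativeRing : IsCommutativeRing _≡_ _+_ _*_ -_ 0# 1#
    0≢1          : 0# ≢ 1#
    inverse      : ∀ x → x ≢ 0# → Σ Carrier (λ y → x * y ≡ 1#)
    isTotalOrder : IsTotalOrder _≡_ _≤_
    <⇒≤×≢        : ∀ x y → x < y → (x ≤ y) × (x ≢ y)
    ≤×≢⇒<        : ∀ x y → x ≤ y → x ≢ y → x < y
    +-mono-≤     : ∀ x y z → x ≤ y → x + z ≤ y + z
    *-nonneg     : ∀ x y → 0# ≤ x → 0# ≤ y → 0# ≤ x * y

ℚ-isOrderedField : IsOrderedField ℚOps
ℚ-isOrderedField = record
  { isCommutativeRing = ℚ.+-*-isCommutativeRing
  ; 0≢1          = λ ()
  ; inverse      = λ x x≢0 → let instance _ = ℚ.≢-nonZero x≢0 in ℚ.1/ x , ℚ.*-inverseʳ x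
  ; isTotalOrder = ℚ.≤-isTotalOrder
  ; <⇒≤×≢        = λ _ _ x<y → ℚ.<⇒≤ x<y , ℚ.<⇒≢ x<y
  ; ≤×≢⇒<        = λ x y x≤y x≢y → ℚ.≰⇒> (x≢y ∘ ℚ.≤-antisym x≤y)
  ; +-mono-≤     = λ _ _ z → ℚ.+-monoˡ-≤ z
  ; *-nonneg     = λ x y 0≤x 0≤y →
      let instance
            _ = ℚ.nonNegative 0≤x
            _ = ℚ.nonNegative 0≤y
      in ℚ.nonNegative⁻¹ (x ℚ.* y) ⦃ ℚ.nonNeg*nonNeg⇒nonNeg x y ⦄
  }

realClosed⇒ordered : ∀ {K} → IsRealClosedField K → IsOrderedField K
realClosed⇒ordered R = record
  { isCommutativeRing = isCommutativeRing ; 0≢1 = 0≢1 ; inverse = inverse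
  ; isTotalOrder = isTotalOrder ; <⇒≤×≢ = <⇒≤×≢ ; ≤×≢⇒< = ≤×≢⇒<
  ; +-mono-≤ = +-mono-≤ ; *-nonneg = *-nonneg }
  where open IsRealClosedField R

QorRCF⇒ordered : ∀ {K} → QorRCF K → IsOrderedField K
QorRCF⇒ordered (inj₁ refl) = ℚ-isOrderedField
QorRCF⇒ordered (inj₂ R)    = realClosed⇒ordered R

-- Order and sign rules in an ordered field

module OrderedField (K : FieldOps) (F : IsOrderedField K) where
  open FieldOps K
  open IsOrderedField F

  commutativeRing : CommutativeRing _ _
  commutativeRing = record { isCommutativeRing = isCommutativeRing }

  open CommutativeRing commutativeRing
    using (ring; commutativeSemiring; +-assoc; +-comm; +-identityˡ; +-identityʳ; -‿inverseˡ; -‿inverseʳ;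
           *-assoc; *-comm; *-identityˡ; *-identityʳ; zeroˡ; zeroʳ; distribˡ; distribʳ)
  open Algebra.Properties.Ring ring using (-‿distribˡ-*; -1*x≈-x; -‿involutive)
  open Algebra.Solver.Ring.NaturalCoefficients.Default commutativeSemiring
    using (solve; _:=_; _:+_; _:*_)
  open IsTotalOrder isTotalOrder using (total; antisym) renaming (refl to ≤-refl; trans to ≤-trans)

  x+y-y : ∀ x y → (x + y) + - y ≡ x
  x+y-y x y = trans (+-assoc x y (- y)) (trans (cong (x +_) (-‿inverseʳ y)) (+-identityʳ x))

  x-y+y : ∀ x y → (x + - y) + y ≡ x
  x-y+y x y = trans (+-assoc x (- y) y) (trans (cong (x +_) (-‿inverseˡ y)) (+-identityʳ x))

  -- If x ≡ y then `total x y` and `total y x` are the same term, so opposite tags refute equality,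
  -- while equal tags give both inequalities.
  infix 4 _≟_
  _≟_ : (x y : Carrier) → Dec (x ≡ y)
  x ≟ y with total x y in eq | total y x in eq′
  ... | inj₁ x≤y | inj₁ y≤x = yes (antisym x≤y y≤x)
  ... | inj₂ y≤x | inj₂ x≤y = yes (antisym x≤y y≤x)
  ... | inj₁ _   | inj₂ _   = no λ { refl → inj₁≢inj₂ (trans (sym eq) eq′) }
  ... | inj₂ _   | inj₁ _   = no λ { refl → inj₁≢inj₂ (trans (sym eq′) eq) }

  <⇒≤ : ∀ {x y} → x < y → x ≤ y
  <⇒≤ = proj₁ ∘ <⇒≤×≢ _ _

  ≤-<-trans : ∀ {x y z} → x ≤ y → y < z → x < z
  ≤-<-trans x≤y y<z = ≤×≢⇒< _ _ (≤-trans x≤y (<⇒≤ y<z))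
    λ { refl → proj₂ (<⇒≤×≢ _ _ y<z) (antisym (<⇒≤ y<z) x≤y) }

  <-≤-trans : ∀ {x y z} → x < y → y ≤ z → x < z
  <-≤-trans x<y y≤z = ≤×≢⇒< _ _ (≤-trans (<⇒≤ x<y) y≤z)
    λ { refl → proj₂ (<⇒≤×≢ _ _ x<y) (antisym (<⇒≤ x<y) y≤z) }

  <-irrefl : ∀ {x} → ¬ (x < x)
  <-irrefl x<x = proj₂ (<⇒≤×≢ _ _ x<x) refl

  ≤⊎> : ∀ x y → x ≤ y ⊎ y < x
  ≤⊎> x y with total x y | x ≟ y
  ... | inj₁ x≤y | _        = inj₁ x≤y
  ... | inj₂ _   | yes refl = inj₁ ≤-refl
  ... | inj₂ y≤x | no x≢y   = inj₂ (≤×≢⇒< _ _ y≤x (x≢y ∘ sym))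

  -- The flag is that of `Row`, so one statement serves strict and weak inequalities: `not` passes
  -- to the complementary relation, and `_∨_` gives the strictness of a sum.
  Rel : Bool → Carrier → Carrier → Set
  Rel true  x y = x < y
  Rel false x y = x ≤ y

  <⇒Rel : ∀ s {x y} → x < y → Rel s x y
  <⇒Rel true  x<y = x<y
  <⇒Rel false x<y = <⇒≤ x<y

  Rel⇒≤ : ∀ s {x y} → Rel s x y → x ≤ y
  Rel⇒≤ true  = <⇒≤
  Rel⇒≤ false x≤y = x≤y

  Rel⊎Rel-not : ∀ s x y → Rel s x y ⊎ Rel (not s) y x
  Rel⊎Rel-not false x y = ≤⊎> x y
  Rel⊎Rel-not true  x y = swap (≤⊎> y x)

  Rel-not-asym : ∀ s {x y} → Rel s x y → ¬ Rel (not s) y x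
  Rel-not-asym true  x<y y≤x = <-irrefl (<-≤-trans x<y y≤x)
  Rel-not-asym false x≤y y<x = <-irrefl (≤-<-trans x≤y y<x)

  Rel-+ : ∀ s {x y} z → Rel s x y → Rel s (x + z) (y + z)
  Rel-+ false z x≤y = +-mono-≤ _ _ z x≤y
  Rel-+ true {x} {y} z x<y = ≤×≢⇒< _ _ (+-mono-≤ _ _ z (<⇒≤ x<y)) λ eq →
    proj₂ (<⇒≤×≢ _ _ x<y) (trans (sym (x+y-y x z)) (trans (cong (_+ - z) eq) (x+y-y y z)))

  Rel-shift : ∀ s {x y x′ y′} z → x + z ≡ x′ → y + z ≡ y′ → Rel s x y → Rel s x′ y′
  Rel-shift s z ex ey r = subst₂ (Rel s) ex ey (Rel-+ s z r)

  +-nonneg : ∀ {x y} → 0# ≤ x → 0# ≤ y → 0# ≤ x + y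
  +-nonneg {x} {y} 0≤x 0≤y = ≤-trans 0≤y (subst (_≤ x + y) (+-identityˡ y) (+-mono-≤ _ _ y 0≤x))

  +-pos-nonneg : ∀ {x y} → 0# < x → 0# ≤ y → 0# < x + y
  +-pos-nonneg {x} {y} 0<x 0≤y = ≤-<-trans 0≤y (subst (_< x + y) (+-identityˡ y) (Rel-+ true y 0<x))

  inverse-≢0 : ∀ {x y} → x * y ≡ 1# → y ≢ 0#
  inverse-≢0 xy≡1 refl = 0≢1 (trans (sym (zeroʳ _)) xy≡1)

  -- `*-nonneg` leaves only equality to exclude: if the product were `0#`, multiplying by the
  -- inverse of `x` would give `y ≡ 0#`.
  *-pos : ∀ {x y} → 0# < x → 0# < y → 0# < x * y
  *-pos {x} {y} 0<x 0<y = ≤×≢⇒< _ _ (*-nonneg _ _ (<⇒≤ 0<x) (<⇒≤ 0<y)) λ 0≡xy →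
    let x⁻¹ , xx⁻¹≡1 = inverse x (proj₂ (<⇒≤×≢ _ _ 0<x) ∘ sym) in
    proj₂ (<⇒≤×≢ _ _ 0<y) (sym (begin
      y               ≡⟨ *-identityˡ y ⟨
      1# * y          ≡⟨ cong (_* y) xx⁻¹≡1 ⟨
      (x * x⁻¹) * y   ≡⟨ solve 3 (λ a b c → (a :* b) :* c := b :* (a :* c)) refl x x⁻¹ y ⟩
      x⁻¹ * (x * y)   ≡⟨ cong (x⁻¹ *_) 0≡xy ⟨
      x⁻¹ * 0#        ≡⟨ zeroʳ x⁻¹ ⟩
      0#              ∎))
    where open ≡-Reasoning

  neg-pos : ∀ {x} → x < 0# → 0# < - x
  neg-pos {x} = Rel-shift true (- x) (-‿inverseʳ x) (+-identityˡ (- x))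

  neg*neg : ∀ x → - x * - x ≡ x * x
  neg*neg x = begin
    - x * - x    ≡⟨ -‿distribˡ-* x (- x) ⟨
    - (x * - x)  ≡⟨ cong -_ (*-comm x (- x)) ⟩
    - (- x * x)  ≡⟨ cong -_ (-‿distribˡ-* x x) ⟨
    - - (x * x)  ≡⟨ -‿involutive (x * x) ⟩
    x * x        ∎
    where open ≡-Reasoning

  square-nonneg : ∀ x → 0# ≤ x * x
  square-nonneg x with ≤⊎> 0# x
  ... | inj₁ 0≤x = *-nonneg _ _ 0≤x 0≤x
  ... | inj₂ x<0 = let 0≤-x = <⇒≤ (neg-pos x<0) in subst (0# ≤_) (neg*neg x) (*-nonneg _ _ 0≤-x 0≤-x)

  0<1 : 0# < 1#
  0<1 = ≤×≢⇒< _ _ (subst (0# ≤_) (*-identityˡ 1#) (square-nonneg 1#)) 0≢1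

  -- The inverse `y` equals `x * (y * y)`, a product of nonnegative factors.
  pos-inverse : ∀ {x} → 0# < x → Σ[ y ∈ Carrier ] (0# < y × x * y ≡ 1#)
  pos-inverse {x} 0<x with inverse x (proj₂ (<⇒≤×≢ _ _ 0<x) ∘ sym)
  ... | y , xy≡1 = y , ≤×≢⇒< _ _ 0≤y (inverse-≢0 xy≡1 ∘ sym) , xy≡1
    where
    0≤y : 0# ≤ y
    0≤y = subst (0# ≤_)
      (trans (solve 2 (λ a b → a :* (b :* b) := (a :* b) :* b) refl x y)
             (trans (cong (_* y) xy≡1) (*-identityˡ y)))
      (*-nonneg _ _ (<⇒≤ 0<x) (square-nonneg y))

  -- By contraposition: were the relation false, totality would give the complementary one the other
  -- way round, and multiplying that by `c` contradicts the hypothesis.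
  *-cancel-Rel : ∀ s {c x y} → 0# < c → Rel s (c * x) (c * y) → Rel s x y
  *-cancel-Rel s {c} {x} {y} 0<c r with Rel⊎Rel-not s x y
  ... | inj₁ x~y = x~y
  ... | inj₂ y~x = contradiction (scaled (not s) y~x) (Rel-not-asym s r)
    where
    split : ∀ x y → c * (x + - y) + c * y ≡ c * x
    split x y = trans (sym (distribˡ c _ _)) (cong (c *_) (x-y+y x y))
    scaled : ∀ s {x y} → Rel s x y → Rel s (c * x) (c * y)
    scaled s {x} {y} x~y = Rel-shift s (c * x) (+-identityˡ _) (split y x)
      (pos s (Rel-shift s (- x) (-‿inverseʳ x) refl x~y))
      where
      pos : ∀ s {z} → Rel s 0# z → Rel s 0# (c * z)
      pos true  = *-pos 0<c
      pos false = *-nonneg _ _ (<⇒≤ 0<c)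

  midpoint : ∀ {x y} → x < y → Σ[ z ∈ Carrier ] (x < z × z < y)
  midpoint {x} {y} x<y with pos-inverse (+-pos-nonneg 0<1 (<⇒≤ 0<1))
  -- `h` is one half. Both comparisons are made after doubling, where they read `x + x < x + y` and
  -- `x + y < y + y`.
  ... | h , _ , 2h≡1 = (x + y) * h
    , *-cancel-Rel true 0<2 (subst₂ _<_ (double x) (sym undo) (subst (x + x <_) (+-comm y x) (Rel-+ true x x<y)))
    , *-cancel-Rel true 0<2 (subst₂ _<_ (sym undo) (double y) (Rel-+ true y x<y))
    where
    0<2 : 0# < 1# + 1#
    0<2 = +-pos-nonneg 0<1 (<⇒≤ 0<1)
    double : ∀ z → z + z ≡ (1# + 1#) * z
    double z = sym (trans (distribʳ z 1# 1#) (cong₂ _+_ (*-identityˡ z) (*-identityˡ z)))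
    undo : (1# + 1#) * ((x + y) * h) ≡ x + y
    undo = trans (solve 3 (λ a b c → a :* (b :* c) := b :* (a :* c)) refl (1# + 1#) (x + y) h)
                 (trans (cong ((x + y) *_) 2h≡1) (*-identityʳ (x + y)))

  above : ∀ s x → Σ[ z ∈ Carrier ] Rel s x z
  above s x = 1# + x , <⇒Rel s (subst (_< 1# + x) (+-identityˡ x) (Rel-+ true x 0<1))

  below : ∀ s x → Σ[ z ∈ Carrier ] Rel s z x
  below s x = x + - 1# , <⇒Rel s (Rel-shift true (x + - 1#) (+-identityˡ _) (trans (+-comm 1# _) (x-y+y x 1#)) 0<1)

  -- A weak side admits its own endpoint as witness; only two strict sides call for the midpoint.
  between : ∀ s s′ {x y} → Rel (s ∨ s′) x y → Σ[ z ∈ Carrier ] (Rel s x z × Rel s′ z y)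
  between false s′    r = _ , ≤-refl , r
  between true  false r = _ , r , ≤-refl
  between true  true  r = midpoint r

  -- Solving one-variable systems

  -- Bounds are compared by implication rather than by value, so that of a strict and a weak bound
  -- at the same value the strict one counts as tighter.
  tightest : ∀ {A : Set} (Q : A → Carrier → Set) →
    (∀ a b → (∀ {z} → Q a z → Q b z) ⊎ (∀ {z} → Q b z → Q a z)) →
    ∀ a as → Σ[ t ∈ A ] (t ∈ a ∷ as × (∀ {z} → Q t z → All (λ b → Q b z) (a ∷ as)))
  tightest Q cmp a [] = a , here refl , λ q → q ∷ []
  tightest Q cmp a (b ∷ as) with tightest Q cmp b as
  ... | t , t∈ , imp with cmp a t
  ...   | inj₁ a⇒t = a , here refl , λ q → q ∷ imp (a⇒t q)
  ...   | inj₂ t⇒a = t , there t∈ , λ q → t⇒a q ∷ imp q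

  lower-total : ∀ s s′ x y → (∀ {z} → Rel s x z → Rel s′ y z) ⊎ (∀ {z} → Rel s′ y z → Rel s x z)
  lower-total s s′ x y with ≤⊎> x y
  lower-total s s′ x y | inj₂ y<x = inj₁ λ r → <⇒Rel s′ (<-≤-trans y<x (Rel⇒≤ s r))
  lower-total false s′ x y | inj₁ x≤y = inj₂ λ r → ≤-trans x≤y (Rel⇒≤ s′ r)
  lower-total true true x y | inj₁ x≤y = inj₂ (≤-<-trans x≤y)
  -- At equal thresholds the strict bound implies the weak one; if `x < y`, the weak bound at `y`
  -- implies the strict bound at `x`.
  lower-total true false x y | inj₁ x≤y with x ≟ y
  ... | yes refl = inj₁ <⇒≤
  ... | no x≢y   = inj₂ (<-≤-trans (≤×≢⇒< _ _ x≤y x≢y))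

  upper-total : ∀ s s′ x y → (∀ {z} → Rel s z x → Rel s′ z y) ⊎ (∀ {z} → Rel s′ z y → Rel s z x)
  upper-total s s′ x y with ≤⊎> y x
  upper-total s s′ x y | inj₂ x<y = inj₁ λ r → <⇒Rel s′ (≤-<-trans (Rel⇒≤ s r) x<y)
  upper-total false s′ x y | inj₁ y≤x = inj₂ λ r → ≤-trans (Rel⇒≤ s′ r) y≤x
  upper-total true true x y | inj₁ y≤x = inj₂ λ z<y → <-≤-trans z<y y≤x
  upper-total true false x y | inj₁ y≤x with y ≟ x
  ... | yes refl = inj₁ <⇒≤
  ... | no y≢x   = inj₂ λ z≤y → ≤-<-trans z≤y (≤×≢⇒< _ _ y≤x y≢x)

  module _ {A : Set} (s : A → Bool) (lo up : A → Carrier) where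
    private
      Lo Up : A → Carrier → Set
      Lo a z = Rel (s a) (lo a) z
      Up a z = Rel (s a) z (up a)

    -- The tightest bound on each side implies all others on that side, so pairwise compatibility is
    -- invoked for one pair only. If one side is empty, a point beyond the tightest bound of the
    -- other suffices.
    between-all : ∀ ls us → (∀ {l u} → l ∈ ls → u ∈ us → Rel (s l ∨ s u) (lo l) (up u)) →
      Σ[ z ∈ Carrier ] (All (λ l → Lo l z) ls × All (λ u → Up u z) us)
    between-all [] [] _ = 0# , [] , []
    between-all (l ∷ ls) [] _
      with t , _ , imp ← tightest Lo (λ a b → lower-total (s a) (s b) (lo a) (lo b)) l ls
      = let z , q = above (s t) (lo t) in z , imp q , []
    between-all [] (u ∷ us) _
      with t , _ , imp ← tightest Up (λ a b → upper-total (s a) (s b) (up a) (up b)) u us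
      = let z , q = below (s t) (up t) in z , [] , imp q
    between-all (l ∷ ls) (u ∷ us) compat
      with t , t∈ , imp ← tightest Lo (λ a b → lower-total (s a) (s b) (lo a) (lo b)) l ls
         | v , v∈ , imp′ ← tightest Up (λ a b → upper-total (s a) (s b) (up a) (up b)) u us
      = let z , q , q′ = between (s t) (s v) (compat t∈ v∈) in z , imp q , imp′ q′

  -- Finite sums

  ∑-cong : ∀ {n} {f g : Fin n → Carrier} → (∀ i → f i ≡ g i) → ∑ K f ≡ ∑ K g
  ∑-cong {zero}  eq = refl
  ∑-cong {suc n} eq = cong₂ _+_ (eq zero) (∑-cong (eq ∘ suc))

  ∑-+ : ∀ {n} (f g : Fin n → Carrier) → ∑ K (λ i → f i + g i) ≡ ∑ K f + ∑ K g
  ∑-+ {zero}  f g = sym (+-identityˡ 0#)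
  ∑-+ {suc n} f g = trans (cong₂ _+_ refl (∑-+ (f ∘ suc) (g ∘ suc)))
    (solve 4 (λ a b c d → (a :+ b) :+ (c :+ d) := (a :+ c) :+ (b :+ d)) refl
      (f zero) (g zero) (∑ K (f ∘ suc)) (∑ K (g ∘ suc)))

  ∑-*ˡ : ∀ {n} c (f : Fin n → Carrier) → ∑ K (λ i → c * f i) ≡ c * ∑ K f
  ∑-*ˡ {zero}  c f = sym (zeroʳ c)
  ∑-*ˡ {suc n} c f = trans (cong₂ _+_ refl (∑-*ˡ c (f ∘ suc))) (sym (distribˡ c _ _))

  ∑-zero : ∀ {n} {f : Fin n → Carrier} → (∀ i → f i ≡ 0#) → ∑ K f ≡ 0#
  ∑-zero {zero}  eq = refl
  ∑-zero {suc n} eq = trans (cong₂ _+_ (eq zero) (∑-zero (eq ∘ suc))) (+-identityˡ 0#)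

  ∑-nonneg : ∀ {n} {f : Fin n → Carrier} → (∀ i → 0# ≤ f i) → 0# ≤ ∑ K f
  ∑-nonneg {zero}  h = ≤-refl
  ∑-nonneg {suc n} h = +-nonneg (h zero) (∑-nonneg (h ∘ suc))

  ∑-comm : ∀ {m n} (f : Fin m → Fin n → Carrier) →
    ∑ K (λ i → ∑ K (f i)) ≡ ∑ K (λ j → ∑ K (λ i → f i j))
  ∑-comm {zero}  f = sym (∑-zero {f = λ j → ∑ K (λ i → f i j)} (λ _ → refl))
  ∑-comm {suc m} f = trans (cong₂ _+_ refl (∑-comm (f ∘ suc))) (sym (∑-+ (f zero) _))

  ∑-split : ∀ m {n} (f : Fin (m ℕ.+ n) → Carrier) →
    ∑ K f ≡ ∑ K (λ i → f (i ↑ˡ n)) + ∑ K (λ i → f (m ↑ʳ i))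
  ∑-split zero    f = sym (+-identityˡ _)
  ∑-split (suc m) f = trans (cong₂ _+_ refl (∑-split m (f ∘ suc))) (sym (+-assoc _ _ _))

  dot-congʳ : ∀ {n} (u : Vect K n) {v w} → (∀ i → v i ≡ w i) → dot K u v ≡ dot K u w
  dot-congʳ u eq = ∑-cong (λ i → cong (u i *_) (eq i))

  dot-+ˡ : ∀ {n} (u v w : Vect K n) → dot K (λ i → u i + v i) w ≡ dot K u w + dot K v w
  dot-+ˡ u v w = trans (∑-cong (λ i → distribʳ (w i) (u i) (v i))) (∑-+ (λ i → u i * w i) _)

  dot-*ˡ : ∀ {n} c (u w : Vect K n) → dot K (λ i → c * u i) w ≡ c * dot K u w
  dot-*ˡ c u w = trans (∑-cong (λ i → *-assoc c (u i) (w i))) (∑-*ˡ c (λ i → u i * w i))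

  dot-negˡ : ∀ {n} (u w : Vect K n) → dot K (negV K u) w ≡ - dot K u w
  dot-negˡ u w = begin
    dot K (negV K u) w             ≡⟨ ∑-cong (λ i → cong (_* w i) (sym (-1*x≈-x (u i)))) ⟩
    dot K (λ i → - 1# * u i) w     ≡⟨ dot-*ˡ (- 1#) u w ⟩
    - 1# * dot K u w               ≡⟨ -1*x≈-x _ ⟩
    - dot K u w                    ∎
    where open ≡-Reasoning

  dot-zeroˡ : ∀ {n} (w : Vect K n) → dot K (zeroV K) w ≡ 0#
  dot-zeroˡ w = ∑-zero (λ i → zeroˡ (w i))

  -- Fourier–Motzkin elimination

  Sat : ∀ {d} → Vect K d → Row K d → Set
  Sat z (row p q s) = Rel s (dot K p z) q

  infixr 5 _∷ᵣ_
  _∷ᵣ_ : ∀ {d} → Carrier → Row K d → Row K (suc d)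
  a ∷ᵣ row p q s = row (a ∷ᵥ p) q s

  infixl 6 _+ᵣ_
  _+ᵣ_ : ∀ {d} → Row K d → Row K d → Row K d
  row p q s +ᵣ row p′ q′ s′ = row (λ i → p i + p′ i) (q + q′) (s ∨ s′)

  infixl 7 _*ᵣ_
  _*ᵣ_ : ∀ {d} → Carrier → Row K d → Row K d
  c *ᵣ row p q s = row (λ i → c * p i) (c * q) s

  -- Elimination derives rows by these closure properties alone. Factors in `scale` are positive
  -- because zero times a strict row would be the false row `0# < 0#`; `resp` is there because
  -- vectors are functions compared pointwise.
  record IsCone {d} (C : Row K d → Set) : Set where
    field
      resp  : ∀ {p p′ q s} → (∀ i → p i ≡ p′ i) → C (row p q s) → C (row p′ q s)
      scale : ∀ {c r} → 0# < c → C r → C (c *ᵣ r)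
      add   : ∀ {r r′} → C r → C r′ → C (r +ᵣ r′)

  -- The rows of a cone not mentioning the first variable form a cone, to which induction applies.
  tailCone : ∀ {d} {C : Row K (suc d) → Set} → IsCone C → IsCone (λ r → C (0# ∷ᵣ r))
  tailCone cone = record
    { resp  = λ eq → resp λ { zero → refl ; (suc i) → eq i }
    ; scale = λ {c} 0<c → resp (λ { zero → zeroʳ c ; (suc i) → refl }) ∘ scale 0<c
    ; add   = λ x y → resp (λ { zero → +-identityˡ 0# ; (suc i) → refl }) (add x y)
    }
    where open IsCone cone

  -- With zero left side the row reads `0# ≤ q` or `0# < q`, and the complementary relation says
  -- that it is false.
  Refutes : ∀ {d} → Row K d → Set
  Refutes (row p q s) = (∀ i → p i ≡ 0#) × Rel (not s) q 0#

  module Elimination {d} (C : Row K (suc d) → Set) (cone : IsCone C) where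
    open IsCone cone

    -- Once the leading coefficient is `1#` or `- 1#`, the row bounds the first variable from above
    -- by its slack or from below by its excess.
    slack excess : Vect K d → Row K d → Carrier
    slack  z (row p q _) = q + - dot K p z
    excess z (row p q _) = dot K p z + - q

    -- The rows are sorted by the sign of their leading coefficient, and a nonzero one is rescaled
    -- to `1#` or `- 1#`. Cone membership is kept so that a refutation found after projection is
    -- still derived from the original rows; `solves` carries a solution back to them.
    record Eliminated (rs : List (Row K (suc d))) : Set where
      field
        flat upper lower : List (Row K d)
        flat-in  : All (λ r → C (0# ∷ᵣ r)) flat
        upper-in : All (λ r → C (1# ∷ᵣ r)) upper
        lower-in : All (λ r → C (- 1# ∷ᵣ r)) lower
        solves : ∀ z₀ z → All (Sat z) flat →
          All (λ r → Rel (Row.strict r) (excess z r) z₀) lower →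
          All (λ r → Rel (Row.strict r) z₀ (slack z r)) upper →
          All (Sat (z₀ ∷ᵥ z)) rs

    private
      scaledSat : ∀ {c} → 0# < c → (a z₀ P q : Carrier) → ∀ s →
        Rel s ((c * a) * z₀ + c * P) (c * q) → Rel s (a * z₀ + P) q
      scaledSat {c} 0<c a z₀ P q s = *-cancel-Rel s 0<c ∘ subst (λ x → Rel s x (c * q))
        (solve 4 (λ c a z P → (c :* a) :* z :+ c :* P := c :* (a :* z :+ P)) refl c a z₀ P)

    eliminate : ∀ rs → All C rs → Eliminated rs
    eliminate [] [] = record
      { flat = [] ; upper = [] ; lower = [] ; flat-in = [] ; upper-in = [] ; lower-in = []
      ; solves = λ _ _ _ _ _ → [] }
    -- Two comparisons fix the sign: when both come out weak, antisymmetry makes the leading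
    -- coefficient zero.
    eliminate (row p q s ∷ rs) (r∈C ∷ rs⊆C) with eliminate rs rs⊆C | ≤⊎> (p zero) 0# | ≤⊎> 0# (p zero)
    ... | E | inj₁ a≤0 | inj₁ 0≤a = record
      { flat = row (p ∘ suc) q s ∷ flat ; upper = upper ; lower = lower
      ; flat-in = resp (λ { zero → antisym a≤0 0≤a ; (suc i) → refl }) r∈C ∷ flat-in
      ; upper-in = upper-in ; lower-in = lower-in
      ; solves = λ { z₀ z (f ∷ fs) ls us →
          subst (λ x → Rel s x q) (sym (drop z₀ _)) f ∷ solves z₀ z fs ls us }
      }
      where
      open Eliminated E
      drop : ∀ z₀ P → p zero * z₀ + P ≡ P
      drop z₀ P = trans (cong (λ a → a * z₀ + P) (antisym a≤0 0≤a))
                        (trans (cong (_+ P) (zeroˡ z₀)) (+-identityˡ P))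
    ... | E | inj₂ 0<a | _ = record
      { flat = flat ; upper = c *ᵣ row (p ∘ suc) q s ∷ upper ; lower = lower
      ; flat-in = flat-in ; lower-in = lower-in
      ; upper-in = resp (λ { zero → ca≡1 ; (suc i) → refl }) (scale 0<c r∈C) ∷ upper-in
      ; solves = λ { z₀ z fs ls (u ∷ us) → bound z₀ z u ∷ solves z₀ z fs ls us }
      }
      where
      open Eliminated E
      c : Carrier
      c = proj₁ (pos-inverse 0<a)
      0<c : 0# < c
      0<c = proj₁ (proj₂ (pos-inverse 0<a))
      ca≡1 : c * p zero ≡ 1#
      ca≡1 = trans (*-comm c _) (proj₂ (proj₂ (pos-inverse 0<a)))
      bound : ∀ z₀ z → Rel s z₀ (slack z (c *ᵣ row (p ∘ suc) q s)) → Sat (z₀ ∷ᵥ z) (row p q s)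
      bound z₀ z u = scaledSat 0<c (p zero) z₀ _ q s (Rel-shift s cP
          (cong₂ _+_ (sym (trans (cong (_* z₀) ca≡1) (*-identityˡ z₀))) (dot-*ˡ c (p ∘ suc) z))
          (x-y+y (c * q) cP) u)
        where
        cP : Carrier
        cP = dot K (λ i → c * p (suc i)) z
    ... | E | inj₁ _ | inj₂ a<0 = record
      { flat = flat ; upper = upper ; lower = c *ᵣ row (p ∘ suc) q s ∷ lower
      ; flat-in = flat-in ; upper-in = upper-in
      ; lower-in = resp (λ { zero → ca≡-1 ; (suc i) → refl }) (scale 0<c r∈C) ∷ lower-in
      ; solves = λ { z₀ z fs (l ∷ ls) us → bound z₀ z l ∷ solves z₀ z fs ls us }
      }
      where
      open Eliminated E
      -- The factor must be positive, hence the inverse of `- p zero`, which turns the leading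
      -- coefficient into `- 1#`.
      inv : Σ[ y ∈ Carrier ] (0# < y × - p zero * y ≡ 1#)
      inv = pos-inverse (neg-pos a<0)
      c : Carrier
      c = proj₁ inv
      0<c : 0# < c
      0<c = proj₁ (proj₂ inv)
      ca≡-1 : c * p zero ≡ - 1#
      ca≡-1 = begin
        c * p zero        ≡⟨ *-comm c _ ⟩
        p zero * c        ≡⟨ -‿involutive _ ⟨
        - - (p zero * c)  ≡⟨ cong -_ (-‿distribˡ-* (p zero) c) ⟩
        - (- p zero * c)  ≡⟨ cong -_ (proj₂ (proj₂ inv)) ⟩
        - 1#              ∎
        where open ≡-Reasoning
      bound : ∀ z₀ z → Rel s (excess z (c *ᵣ row (p ∘ suc) q s)) z₀ → Sat (z₀ ∷ᵥ z) (row p q s)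
      -- Adding `c * q + - z₀` to both sides of the lower bound exchanges `c * q` and `z₀`, which
      -- gives the scaled row.
      bound z₀ z l = scaledSat 0<c (p zero) z₀ _ q s (Rel-shift s (c * q + - z₀) left right l)
        where
        open ≡-Reasoning
        cP : Carrier
        cP = dot K (λ i → c * p (suc i)) z
        left : (cP + - (c * q)) + (c * q + - z₀) ≡ (c * p zero) * z₀ + c * dot K (p ∘ suc) z
        left = begin
          (cP + - (c * q)) + (c * q + - z₀)              ≡⟨ +-assoc _ (c * q) (- z₀) ⟨
          ((cP + - (c * q)) + c * q) + - z₀              ≡⟨ cong (_+ - z₀) (x-y+y cP (c * q)) ⟩
          cP + - z₀                                      ≡⟨ +-comm cP (- z₀) ⟩
          - z₀ + cP                                      ≡⟨ cong (_+ cP) (-1*x≈-x z₀) ⟨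
          - 1# * z₀ + cP                                 ≡⟨ cong₂ (λ a P → a * z₀ + P) (sym ca≡-1) (dot-*ˡ c (p ∘ suc) z) ⟩
          (c * p zero) * z₀ + c * dot K (p ∘ suc) z      ∎
        right : z₀ + (c * q + - z₀) ≡ c * q
        right = trans (+-comm z₀ _) (x-y+y (c * q) z₀)

    module _ {rs} (E : Eliminated rs) where
      open Eliminated E

      -- In each sum of a lower and an upper row the leading coefficients `- 1#` and `1#` cancel,
      -- which leaves a consequence free of the first variable.
      projected : List (Row K d)
      projected = flat ++ cartesianProductWith _+ᵣ_ lower upper

      projected-in : All (λ r → C (0# ∷ᵣ r)) projected
      projected-in = ++⁺ flat-in (All.tabulate λ r∈ → sums (∈-cartesianProductWith⁻ _+ᵣ_ lower upper r∈))
        where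
        sums : ∀ {r} → (Σ[ l ∈ Row K d ] Σ[ u ∈ Row K d ] (l ∈ lower × u ∈ upper × r ≡ l +ᵣ u)) → C (0# ∷ᵣ r)
        sums (_ , _ , l∈ , u∈ , refl) =
          resp (λ { zero → -‿inverseˡ 1# ; (suc i) → refl })
            (add (All.lookup lower-in l∈) (All.lookup upper-in u∈))

      -- The summed row relates `P + P′` to `q + q′`; adding `- q + - P′` to both sides turns them
      -- into the excess of `l` and the slack of `u`.
      compatible : ∀ z (l u : Row K d) → Sat z (l +ᵣ u) →
        Rel (Row.strict l ∨ Row.strict u) (excess z l) (slack z u)
      compatible z (row p q s) (row p′ q′ s′) r = Rel-shift (s ∨ s′) (- q + - P′)
        (trans (cong (_+ (- q + - P′)) (trans (dot-+ˡ p p′ z) (+-comm P P′)))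
          (trans (solve 4 (λ a b c d → (a :+ b) :+ (c :+ d) := ((b :+ c) :+ a) :+ d) refl P′ P (- q) (- P′))
            (x+y-y _ P′)))
        (trans (solve 4 (λ a b c d → (a :+ b) :+ (c :+ d) := ((b :+ d) :+ a) :+ c) refl q q′ (- q) (- P′))
          (x+y-y _ q))
        r
        where
        P P′ : Carrier
        P  = dot K p z
        P′ = dot K p′ z

      extend : ∀ z → All (Sat z) projected → Σ[ z₀ ∈ Carrier ] All (Sat (z₀ ∷ᵥ z)) rs
      extend z sat =
        let fs , sums = ++⁻ flat sat
            z₀ , ls , us = between-all Row.strict (excess z) (slack z) lower upper
              λ {l} {u} l∈ u∈ → compatible z l u (All.lookup sums (∈-cartesianProductWith⁺ _+ᵣ_ l∈ u∈))
        in z₀ , solves z₀ z fs ls us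

  -- Induction on the number of variables. A solution of the projected system extends to the first
  -- variable; a refutation of it lies in the tail cone, so a leading zero makes it one in `C`.
  fourierMotzkin : ∀ {d} {C : Row K d → Set} → IsCone C → ∀ rs → All C rs →
    (Σ[ z ∈ Vect K d ] All (Sat z) rs) ⊎ (Σ[ r ∈ Row K d ] (C r × Refutes r))
  fourierMotzkin {zero} cone [] [] = inj₁ ((λ ()) , [])
  -- Without variables a row is a closed statement about `q`: it holds, or it is itself the
  -- refutation.
  fourierMotzkin {zero} cone (row p q s ∷ rs) (r∈C ∷ rs⊆C)
    with Rel⊎Rel-not s 0# q | fourierMotzkin cone rs rs⊆C
  ... | inj₂ q~0 | _              = inj₂ (_ , r∈C , (λ ()) , q~0)
  ... | inj₁ _   | inj₂ refuted   = inj₂ refuted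
  ... | inj₁ 0~q | inj₁ (z , sat) = inj₁ (z , 0~q ∷ sat)
  fourierMotzkin {suc d} {C} cone rs rs⊆C
    with E ← Elimination.eliminate C cone rs rs⊆C
    with fourierMotzkin (tailCone cone) (Elimination.projected C cone E) (Elimination.projected-in C cone E)
  ... | inj₁ (z , sat) = let z₀ , sat′ = Elimination.extend C cone E z sat in inj₁ (z₀ ∷ᵥ z , sat′)
  ... | inj₂ (r , r∈C , p≡0 , q~0) = inj₂ (0# ∷ᵣ r , r∈C , (λ { zero → refl ; (suc i) → p≡0 i }) , q~0)

  -- Motzkin's transposition theorem

  δ : ∀ {n} → Fin n → Vect K n
  δ zero    zero    = 1#
  δ zero    (suc j) = 0#
  δ (suc i) zero    = 0#
  δ (suc i) (suc j) = δ i j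

  δ-nonneg : ∀ {n} (i j : Fin n) → 0# ≤ δ i j
  δ-nonneg zero    zero    = <⇒≤ 0<1
  δ-nonneg zero    (suc j) = ≤-refl
  δ-nonneg (suc i) zero    = ≤-refl
  δ-nonneg (suc i) (suc j) = δ-nonneg i j

  dot-δ : ∀ {n} (i : Fin n) (w : Vect K n) → dot K (δ i) w ≡ w i
  dot-δ zero    w = trans (cong₂ _+_ (*-identityˡ _) (dot-zeroˡ (w ∘ suc))) (+-identityʳ _)
  dot-δ (suc i) w = trans (cong₂ _+_ (zeroˡ _) (dot-δ i (w ∘ suc))) (+-identityˡ _)

  module _ {d} (rs : List (Row K d)) where
    private
      strict : Fin (length rs) → Bool
      strict k = Row.strict (lookup rs k)

      coeff : Fin d → Vect K (length rs)
      coeff i k = Row.p (lookup rs k) i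

      -- Through these vectors the conditional sums of `Motzkin` become dot products with `κ`, to
      -- which linearity applies.
      rhs weakRhs strictness : Vect K (length rs)
      rhs k = Row.q (lookup rs k)
      weakRhs k = if strict k then 0# else rhs k
      strictness k = if strict k then 1# else 0#

      -- The invariant is matched to the two final alternatives of `Motzkin`. A strict consequence
      -- puts positive total weight on strict rows; for a weak one the weak rows alone give `q`, so
      -- `q < 0#` is the first alternative.
      StrictnessOf : Bool → Carrier → Vect K (length rs) → Set
      StrictnessOf true  q κ = 0# < dot K κ strictness
      StrictnessOf false q κ = dot K κ weakRhs ≡ q

      strictness-nonneg : ∀ k → 0# ≤ strictness k
      strictness-nonneg k with strict k
      ... | true  = <⇒≤ 0<1
      ... | false = ≤-refl

    -- The cone generated by `rs`; the multipliers `κ` are the ones that `Motzkin` asks for.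
    record Combination (r : Row K d) : Set where
      field
        κ        : Vect K (length rs)
        κ-nonneg : ∀ k → 0# ≤ κ k
        κ-coeff  : ∀ i → dot K κ (coeff i) ≡ Row.p r i
        κ-rhs    : dot K κ rhs ≡ Row.q r
        κ-strict : StrictnessOf (Row.strict r) (Row.q r) κ

      weight-nonneg : 0# ≤ dot K κ strictness
      weight-nonneg = ∑-nonneg λ k → *-nonneg _ _ (κ-nonneg k) (strictness-nonneg k)

    open Combination

    scaleCombination : ∀ {a r} → 0# < a → Combination r → Combination (a *ᵣ r)
    scaleCombination {a} {r} 0<a c = record
      { κ = λ k → a * κ c k
      ; κ-nonneg = λ k → *-nonneg _ _ (<⇒≤ 0<a) (κ-nonneg c k)
      ; κ-coeff = λ i → trans (dot-*ˡ a (κ c) (coeff i)) (cong (a *_) (κ-coeff c i))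
      ; κ-rhs = trans (dot-*ˡ a (κ c) rhs) (cong (a *_) (κ-rhs c))
      ; κ-strict = scale-strict (Row.strict r) (κ-strict c) }
      where
      scale-strict : ∀ s → StrictnessOf s (Row.q r) (κ c) → StrictnessOf s (a * Row.q r) (λ k → a * κ c k)
      scale-strict true  h = subst (0# <_) (sym (dot-*ˡ a (κ c) strictness)) (*-pos 0<a h)
      scale-strict false h = trans (dot-*ˡ a (κ c) weakRhs) (cong (a *_) h)

    -- One strict summand makes the sum strict: its positive weight cannot be cancelled, since the
    -- weight of the other summand is nonnegative.
    addCombination : ∀ {r r′} → Combination r → Combination r′ → Combination (r +ᵣ r′)
    addCombination {r} {r′} c c′ = record
      { κ = λ k → κ c k + κ c′ k
      ; κ-nonneg = λ k → +-nonneg (κ-nonneg c k) (κ-nonneg c′ k)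
      ; κ-coeff = λ i → trans (sum (coeff i)) (cong₂ _+_ (κ-coeff c i) (κ-coeff c′ i))
      ; κ-rhs = trans (sum rhs) (cong₂ _+_ (κ-rhs c) (κ-rhs c′))
      ; κ-strict = add-strict (Row.strict r) (Row.strict r′) (κ-strict c) (κ-strict c′) }
      where
      sum : ∀ w → dot K (λ k → κ c k + κ c′ k) w ≡ dot K (κ c) w + dot K (κ c′) w
      sum = dot-+ˡ (κ c) (κ c′)
      add-strict : ∀ s s′ → StrictnessOf s (Row.q r) (κ c) → StrictnessOf s′ (Row.q r′) (κ c′) →
        StrictnessOf (s ∨ s′) (Row.q r + Row.q r′) (λ k → κ c k + κ c′ k)
      add-strict true  s′    h _  = subst (0# <_) (sym (sum strictness)) (+-pos-nonneg h (weight-nonneg c′))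
      add-strict false true  _ h′ = subst (0# <_) (trans (+-comm _ _) (sym (sum strictness)))
                                      (+-pos-nonneg h′ (weight-nonneg c))
      add-strict false false h h′ = trans (sum weakRhs) (cong₂ _+_ h h′)

    combination-isCone : IsCone Combination
    combination-isCone = record
      { resp  = λ eq c → record
          { κ = κ c ; κ-nonneg = κ-nonneg c ; κ-coeff = λ i → trans (κ-coeff c i) (eq i)
          ; κ-rhs = κ-rhs c ; κ-strict = κ-strict c }
      ; scale = scaleCombination
      ; add   = addCombination
      }

    -- Unit vectors as multipliers select single rows.
    generator : ∀ {r} → r ∈ rs → Combination r
    generator r∈rs = subst Combination (sym (lookup-index r∈rs)) (record
      { κ = δ k ; κ-nonneg = δ-nonneg k ; κ-coeff = λ i → dot-δ k (coeff i) ; κ-rhs = dot-δ k rhs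
      ; κ-strict = strict-δ (strict k) refl })
      where
      k : Fin (length rs)
      k = index r∈rs
      strict-δ : ∀ s → strict k ≡ s → StrictnessOf s (rhs k) (δ k)
      strict-δ true  eq = subst (0# <_)
        (sym (trans (dot-δ k strictness) (cong (λ s → if s then 1# else 0#) eq))) 0<1
      strict-δ false eq = trans (dot-δ k weakRhs) (cong (λ s → if s then 0# else rhs k) eq)

    -- The multipliers of the refuting row are the witness; its strictness decides which final
    -- alternative holds.
    refutation⇒Motzkin : ∀ {r} → Combination r → Refutes r → Motzkin K rs
    refutation⇒Motzkin {row p q s} c (p≡0 , q~0) =
      κ c , κ-nonneg c , (λ i → trans (κ-coeff c i) (p≡0 i))
        , subst (_≤ 0#) (sym (κ-rhs c)) (Rel⇒≤ (not s) q~0) , alternative s q~0 (κ-strict c)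
      where
      weak : ∀ x y s → x * (if s then 0# else y) ≡ (if s then 0# else x * y)
      weak x y true  = zeroʳ x
      weak x y false = refl
      weight : ∀ x s → x * (if s then 1# else 0#) ≡ (if s then x else 0#)
      weight x true  = *-identityʳ x
      weight x false = zeroʳ x
      alternative : ∀ s → Rel (not s) q 0# → StrictnessOf s q (κ c) →
        (∑ K (λ k → if strict k then 0# else κ c k * rhs k) < 0#) ⊎ (0# < ∑ K (λ k → if strict k then κ c k else 0#))
      alternative true  _   h = inj₂ (subst (0# <_) (∑-cong λ k → weight (κ c k) (strict k)) h)
      alternative false q<0 h = inj₁ (subst (_< 0#) (trans (sym h) (∑-cong λ k → weak (κ c k) (rhs k) (strict k))) q<0)

    -- Elimination is run in the cone of combinations of `rs`; insolubility leaves only the refuting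
    -- alternative.
    motzkin : (∀ z → ¬ All (Sat z) rs) → Motzkin K rs
    motzkin unsat with fourierMotzkin combination-isCone rs (All.tabulate generator)
    ... | inj₁ (z , sat)         = contradiction sat (unsat z)
    ... | inj₂ (r , c , refutes) = refutation⇒Motzkin c refutes

  -- Reading off the rows of the transformed constraint

  conjRows⇒ : ∀ {d} (c : Conj K d) z → All (Sat z) (conjRows K c) → ⟦_⟧C K c z
  conjRows⇒ c z sat = let weak , strict = ++⁻ _ sat in tabulate⁻ weak , tabulate⁻ strict

  -- Needed because a vector is only pointwise equal to the stack of its halves.
  ⟦⟧C-cong : ∀ {d} (c : Conj K d) {z z′} → (∀ i → z i ≡ z′ i) → ⟦_⟧C K c z → ⟦_⟧C K c z′
  ⟦⟧C-cong c eq (weak , strict) =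
      (λ k → subst (_≤ b k) (dot-congʳ (B k) eq) (weak k))
    , (λ k → subst (_< b′ k) (dot-congʳ (B′ k) eq) (strict k))
    where open Conj c renaming (B' to B′; b' to b′)

  holds⇒Rel : ∀ r {x} → holds K r x → Rel (isStrict r) 0# x
  holds⇒Rel geq h = h
  holds⇒Rel gt  h = h

  Rel⇒holds : ∀ r {x} → Rel (isStrict r) 0# x → holds K r x
  Rel⇒holds geq h = h
  Rel⇒holds gt  h = h

  holds-¬ : ∀ r {x y} → holds K r (x + - y) → ¬ Rel (not (isStrict r)) x y
  holds-¬ r {x} {y} h = Rel-not-asym (isStrict r)
    (Rel-shift (isStrict r) y (+-identityˡ y) (x-y+y x y) (holds⇒Rel r h))

  posRow⇒holds : ∀ {d} (s : Vect K d) t r z → Sat z (posRow K s t r) → holds K r (dot K s z + t)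
  posRow⇒holds s t r z sat = Rel⇒holds r (Rel-shift (isStrict r) (dot K s z)
    (trans (cong₂ _+_ (dot-negˡ s z) refl) (-‿inverseˡ _)) (+-comm t _) sat)

  negRow⇒¬holds : ∀ {d} (s : Vect K d) t r z → Sat z (negRow K s t r) → ¬ holds K r (dot K s z + t)
  negRow⇒¬holds s t r z sat h = holds-¬ r (subst (λ t → holds K r (dot K s z + t)) (sym (-‿involutive t)) h) sat

  -- Stacked vectors and template atoms

  module _ {n : ℕ} where
    fstV sndV : Vect K (n ℕ.+ n) → Vect K n
    fstV z i = z (i ↑ˡ n)
    sndV z i = z (n ↑ʳ i)

    -- Lets a solution `z` in `n + n` variables be read as a transition from `fstV z` to `sndV z`.
    stack-fst-snd : ∀ z i → z i ≡ stack K (fstV z) (sndV z) i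
    stack-fst-snd z i = trans (cong z (sym (join-splitAt n n i))) (lemma (splitAt n i))
      where
      lemma : ∀ s → z ([ _↑ˡ n , n ↑ʳ_ ] s) ≡ [ fstV z , sndV z ] s
      lemma (inj₁ _) = refl
      lemma (inj₂ _) = refl

    dot-stack : ∀ (u v : Vect K n) z → dot K (stack K u v) z ≡ dot K u (fstV z) + dot K v (sndV z)
    dot-stack u v z = trans (∑-split n _) (cong₂ _+_
      (∑-cong λ i → cong (λ s → [ u , v ] s * fstV z i) (splitAt-↑ˡ n i n))
      (∑-cong λ i → cong (λ s → [ u , v ] s * sndV z i) (splitAt-↑ʳ n n i)))

    dot-stack-0ʳ : ∀ (u : Vect K n) z → dot K (stack K u (zeroV K)) z ≡ dot K u (fstV z)
    dot-stack-0ʳ u z = trans (dot-stack u (zeroV K) z) (trans (cong₂ _+_ refl (dot-zeroˡ (sndV z))) (+-identityʳ _))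

    dot-stack-0ˡ : ∀ (u : Vect K n) z → dot K (stack K (zeroV K) u) z ≡ dot K u (sndV z)
    dot-stack-0ˡ u z = trans (dot-stack (zeroV K) u z) (trans (cong₂ _+_ (dot-zeroˡ (fstV z)) refl) (+-identityˡ _))

    -- Both sides are one double sum, taken in the two orders.
    dot-∑ : ∀ {m} (a : Fin m → Carrier) (s : Fin m → Vect K n) x →
      dot K (λ k → ∑ K (λ f → a f * s f k)) x ≡ ∑ K (λ f → a f * dot K (s f) x)
    dot-∑ a s x = begin
      ∑ K (λ k → ∑ K (λ f → a f * s f k) * x k)      ≡⟨ ∑-cong (λ k → trans (*-comm _ (x k)) (sym (∑-*ˡ (x k) (λ f → a f * s f k)))) ⟩
      ∑ K (λ k → ∑ K (λ f → x k * (a f * s f k)))    ≡⟨ ∑-comm (λ k f → x k * (a f * s f k)) ⟩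
      ∑ K (λ f → ∑ K (λ k → x k * (a f * s f k)))    ≡⟨ ∑-cong (λ f → trans
                                                          (∑-cong λ k → trans (*-comm (x k) _) (*-assoc (a f) _ _))
                                                          (∑-*ˡ (a f) (λ k → s f k * x k))) ⟩
      ∑ K (λ f → a f * dot K (s f) x)                ∎
      where open ≡-Reasoning

    -- Regrouping separates the part linear in `z` from the constants `t` and `dval`; the sign in
    -- `atomE` disappears by double negation.
    atomVal-dot : ∀ {T : TemplateCNF K} (a : TAssign K n T) A z →
      atomVal K a A (fstV z) (sndV z) ≡ dot K (atomD K a A) z + - atomE K a A
    atomVal-dot a A z = begin
      ∑ K (λ f → α f * (u f + t f) + β f * (v f + t f)) + D
        ≡⟨ cong (_+ D) (∑-cong λ f → solve 5
             (λ α u t β v → α :* (u :+ t) :+ β :* (v :+ t) := (α :* u :+ β :* v) :+ (α :+ β) :* t)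
             refl (α f) (u f) (t f) (β f) (v f)) ⟩
      ∑ K (λ f → (α f * u f + β f * v f) + (α f + β f) * t f) + D
        ≡⟨ cong (_+ D) (trans (∑-+ (λ f → α f * u f + β f * v f) _) (cong₂ _+_ (∑-+ (λ f → α f * u f) _) refl)) ⟩
      (∑ K (λ f → α f * u f) + ∑ K (λ f → β f * v f)) + ∑ K (λ f → (α f + β f) * t f) + D
        ≡⟨ +-assoc _ _ D ⟩
      (∑ K (λ f → α f * u f) + ∑ K (λ f → β f * v f)) + (∑ K (λ f → (α f + β f) * t f) + D)
        ≡⟨ cong₂ _+_ (sym (trans (dot-stack _ _ z) (cong₂ _+_ (dot-∑ α s (fstV z)) (dot-∑ β s (sndV z)))))
                     (sym (-‿involutive _)) ⟩
      dot K (atomD K a A) z + - atomE K a A ∎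
      where
      open ≡-Reasoning
      open TAssign a
      open Atom A
      u v : Fin _ → Carrier
      u f = dot K (s f) (fstV z)
      v f = dot K (s f) (sndV z)
      D : Carrier
      D = ∑ K (λ d → γ d * dval d)

    negAtomRow⇒¬holds : ∀ {T : TemplateCNF K} (a : TAssign K n T) A z →
      Sat z (negAtomRow K (atomD K a A) (atomE K a A) (Atom.rel A)) →
      ¬ holds K (Atom.rel A) (atomVal K a A (fstV z) (sndV z))
    negAtomRow⇒¬holds a A z sat h = holds-¬ (Atom.rel A) (subst (holds K (Atom.rel A)) (atomVal-dot a A z) h) sat

    posRow-stack⇒ψ : ∀ (s : Vect K n) t r z → Sat z (posRow K (stack K s (zeroV K)) t r) →
      holds K r (dot K s (fstV z) + t)
    posRow-stack⇒ψ s t r z sat =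
      subst (λ x → holds K r (x + t)) (dot-stack-0ʳ s z) (posRow⇒holds (stack K s (zeroV K)) t r z sat)

    conjRows⇒loopP : ∀ (P : LassoNF K n) m z → All (Sat z) (conjRows K (LassoNF.loopC P m)) →
      loopP K P (fstV z) (sndV z)
    conjRows⇒loopP P m z sat =
      m , ⟦⟧C-cong (LassoNF.loopC P m) (stack-fst-snd z) (conjRows⇒ (LassoNF.loopC P m) z sat)

  -- From the original to the transformed constraint

  Sat0⇒Sat5 : ∀ {n} (P : LassoNF K n) T nL ▷ → Sat0 K P T nL ▷ → Sat5 K P T nL ▷
  Sat0⇒Sat5 P T nL ▷ (sL , tL , a , initial , preserved , ranked) =
    (λ ℓ _ _ → sL ℓ) , (λ ℓ _ _ → tL ℓ) , a , II5 , IC5 , TI5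
    where
    open LassoNF P
    open TemplateCNF T

    II5 : ∀ ℓ (i : Fin nI) (m : Fin nM) ν → Motzkin K (conjRows K (stemC ν) ++ (negRow K (sL ℓ) (tL ℓ) (▷ ℓ) ∷ []))
    II5 ℓ _ _ ν = motzkin _ unsat
      where
      unsat : ∀ z → ¬ All (Sat z) (conjRows K (stemC ν) ++ (negRow K (sL ℓ) (tL ℓ) (▷ ℓ) ∷ []))
      unsat z sat with stem , ¬ψ ∷ [] ← ++⁻ (conjRows K (stemC ν)) sat =
        negRow⇒¬holds (sL ℓ) (tL ℓ) (▷ ℓ) z ¬ψ (initial ℓ z (ν , conjRows⇒ (stemC ν) z stem))

    IC5 : ∀ ℓ (i : Fin nI) (m : Fin nM) m₁ → Motzkin K
      (posRow K (stack K (sL ℓ) (zeroV K)) (tL ℓ) (▷ ℓ)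
        ∷ (conjRows K (loopC m₁) ++ (negRow K (stack K (zeroV K) (sL ℓ)) (tL ℓ) (▷ ℓ) ∷ [])))
    IC5 ℓ _ _ m₁ = motzkin _ unsat
      where
      unsat : ∀ z → ¬ All (Sat z) (posRow K (stack K (sL ℓ) (zeroV K)) (tL ℓ) (▷ ℓ)
        ∷ (conjRows K (loopC m₁) ++ (negRow K (stack K (zeroV K) (sL ℓ)) (tL ℓ) (▷ ℓ) ∷ [])))
      -- A solution would be a loop step from a state satisfying the invariant to one violating it.
      unsat z (ψx ∷ sat) with loop , ¬ψx′ ∷ [] ← ++⁻ (conjRows K (loopC m₁)) sat =
        negRow⇒¬holds (stack K (zeroV K) (sL ℓ)) (tL ℓ) (▷ ℓ) z ¬ψx′
          (subst (λ x → holds K (▷ ℓ) (x + tL ℓ)) (sym (dot-stack-0ˡ (sL ℓ) z))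
            (preserved ℓ (fstV z) (sndV z) (posRow-stack⇒ψ (sL ℓ) (tL ℓ) (▷ ℓ) z ψx) (conjRows⇒loopP P m₁ z loop)))

    TI5 : ∀ i m → Motzkin K (conjRows K (loopC m)
      ++ tabulate (λ ℓ → posRow K (stack K (sL ℓ) (zeroV K)) (tL ℓ) (▷ ℓ))
      ++ tabulate (λ j → negAtomRow K (atomD K a (atom i j)) (atomE K a (atom i j)) (Atom.rel (atom i j))))
    TI5 i m = motzkin _ unsat
      where
      unsat : ∀ z → ¬ All (Sat z) (conjRows K (loopC m)
        ++ tabulate (λ ℓ → posRow K (stack K (sL ℓ) (zeroV K)) (tL ℓ) (▷ ℓ))
        ++ tabulate (λ j → negAtomRow K (atomD K a (atom i j)) (atomE K a (atom i j)) (Atom.rel (atom i j))))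
      unsat z sat =
        -- A solution would be a transition with all invariants true at its source, so some disjunct
        -- `j` of clause `i` holds, against the row that negates it.
        let loop , sat′  = ++⁻ (conjRows K (loopC m)) sat
            ψs , ¬atoms  = ++⁻ (tabulate _) sat′
            j , holds-ij = ranked (fstV z) (sndV z) (conjRows⇒loopP P m z loop)
              (λ ℓ → posRow-stack⇒ψ (sL ℓ) (tL ℓ) (▷ ℓ) z (tabulate⁻ ψs ℓ)) i
        in negAtomRow⇒¬holds a (atom i j) z (tabulate⁻ ¬atoms j) holds-ij

theorem5p4 : (K : FieldOps) → QorRCF K →
    (n : ℕ) (P : LassoNF K n) (T : TemplateCNF K) →
    IsRankingTemplate K n T →
    (nL : ℕ) (▷ : Fin nL → Strictness) →
    Sat0 K P T nL ▷ → Sat5 K P T nL ▷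
theorem5p4 K QR n P T _ nL ▷ = OrderedField.Sat0⇒Sat5 K (QorRCF⇒ordered QR) P T nL ▷
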